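{- Let $Q=T[H_1,\dots,H_t]$ be a semicomplete composition. Then $Q$ contains an acyclic spanning subdigraph $R$ with a source $x$ and a sink $y$ such that for each vertex $z$ of $Q$, $R$ contains an $x$--$z$ path and a $z$--$y$ path, if one of the following assertions holds: (a) $Q$ is non-strong and has both in- and out-branchings (i.e., at least one in-branching and at least one out-branching); (b) $Q$ is strong with $|V(H_i)|\ge 2$ for each $i\in\{1,\dots,t\}$.
   Context: Digraphs are finite, without loops or parallel arcs (2-cycles are allowed); paths and cycles are directed, and a single vertex is a (trivial) path. A digraph is semicomplete if there is at least one arc between every pair of distinct vertices. Let $T$ be a digraph with vertices $u_1,\dots,u_t$ ($t\ge 2$) and let $H_1,\dots,H_t$ be pairwise disjoint nonempty digraphs. The composition $Q=T[H_1,\dots,H_t]$ is the digraph with vertex set $\bigcup_i V(H_i)$ and arc set $\bigcup_{i=1}^t A(H_i)\cup\{xy : x\in V(H_i),\ y\in V(H_p),\ u_iu_p\in A(T)\}$. It is a semicomplete composition if $T$ is semicomplete. A digraph is strong if for every ordered pair of vertices $(x,y)$ there is a directed path from $x$ to $y$. A digraph is acyclic if it has no directed cycle (including 2-cycles). A source (resp. sink) is a vertex of in-degree zero (resp. out-degree zero). An out-tree (resp. in-tree) rooted at $r$ is an orientation of a tree in which every vertex except $r$ has in-degree (resp. out-degree) one. An out-branching (resp. in-branching) of $D$ is a spanning subdigraph of $D$ which is an out-tree (resp. in-tree). -}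

module Defs where

open import Data.Fin.Base using (Fin; zero; suc)
open import Data.Fin.Properties using (+↔⊎; inj⇒≟)
open import Data.List.Base using (List; []; _∷_; length; filter; tabulate)
open import Data.List.Relation.Unary.Unique.Propositional using (Unique)
open import Data.Nat.Base using (ℕ; zero; suc; _+_; _≤_)
open import Data.Product.Base using (Σ; Σ-syntax; ∃-syntax; _×_; _,_; proj₁)
open import Data.Product.Function.Dependent.Propositional using (Σ-↔)
open import Data.Sum.Base using (_⊎_; inj₁; inj₂)
open import Data.Sum.Function.Propositional using (_⊎-↔_)
open import Data.Vec.Functional using (foldr)
open import Function.Base using (_∘_)
open import Function.Bundles using (_↔_; Inverse; mk↔ₛ′)
open import Function.Construct.Identity using (↔-id)
open import Function.Construct.Composition using (_↔-∘_)
open import Function.Construct.Symmetry using (↔-sym)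
open import Function.Properties.Inverse using (↔⇒↣)
open import Level using (0ℓ)
open import Relation.Binary.Construct.Closure.ReflexiveTransitive using (Star; ε; _◅_)
open import Relation.Binary.Construct.Closure.Symmetric using (SymClosure)
open import Relation.Binary.Core using (Rel)
open import Relation.Binary.Definitions using (Decidable; DecidableEquality)
open import Relation.Binary.PropositionalEquality using (_≡_; _≢_; refl)
open import Relation.Nullary using (¬_; yes; no)

-- Arcs form a relation, so there are no parallel arcs. Decidability of
-- adjacency is what makes the arc set, and not only the vertex set, finite
-- constructively.
record Digraph : Set₁ where
  field
    V       : Set
    order   : ℕ
    enum    : V ↔ Fin order
    Arc     : Rel V 0ℓ
    arc?    : Decidable Arc
    no-loop : ∀ {x} → ¬ Arc x x

  _≟V_ : DecidableEquality V
  _≟V_ = inj⇒≟ (↔⇒↣ enum)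

  vertices : List V
  vertices = tabulate (Inverse.from enum)

  inDegree outDegree : V → ℕ
  inDegree  x = length (filter (λ w → arc? w x) vertices)
  outDegree x = length (filter (λ w → arc? x w) vertices)

  IsSource IsSink : V → Set
  IsSource x = inDegree x ≡ 0
  IsSink   x = outDegree x ≡ 0

open Digraph public using (V; order; Arc)

-- Paths and cycles in an arbitrary relation, used both for the arcs of a
-- digraph and for the edges of its underlying undirected graph.
module _ {A : Set} {_⟶_ : Rel A 0ℓ} where

  walkVertices : ∀ {x y} → Star _⟶_ x y → List A
  walkVertices {x} ε       = x ∷ []
  walkVertices {x} (_ ◅ w) = x ∷ walkVertices w

Path : {A : Set} → Rel A 0ℓ → Rel A 0ℓ
Path _⟶_ x y = Σ[ w ∈ Star _⟶_ x y ] Unique (walkVertices w)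

-- A cycle with at least k vertices: a path x … y closed up by a step y ⟶ x.
Cycle : {A : Set} → ℕ → Rel A 0ℓ → Set
Cycle k _⟶_ =
  ∃[ x ] ∃[ y ] Σ[ p ∈ Path _⟶_ x y ] (k ≤ length (walkVertices (proj₁ p)) × y ⟶ x)

Semicomplete : Digraph → Set
Semicomplete D = ∀ (x y : V D) → x ≢ y → Arc D x y ⊎ Arc D y x

Strong : Digraph → Set
Strong D = ∀ (x y : V D) → Path (Arc D) x y

Acyclic : Digraph → Set
Acyclic D = ¬ Cycle 2 (Arc D)

record SpanningSubdigraph (D : Digraph) : Set₁ where
  field
    SubArc  : Rel (V D) 0ℓ
    subArc? : Decidable SubArc
    subArc⊆ : ∀ {x y} → SubArc x y → Arc D x y

  digraph : Digraph
  digraph = record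
    { V       = V D
    ; order   = order D
    ; enum    = Digraph.enum D
    ; Arc     = SubArc
    ; arc?    = subArc?
    ; no-loop = λ a → Digraph.no-loop D (subArc⊆ a)
    }

-- Edges of the underlying undirected graph.
Edge : (D : Digraph) → Rel (V D) 0ℓ
Edge D = SymClosure (Arc D)

record IsOrientedTree (D : Digraph) : Set where
  field
    oriented  : ∀ {x y : V D} → Arc D x y → ¬ Arc D y x
    connected : ∀ (x y : V D) → Path (Edge D) x y
    noCycle   : ¬ Cycle 3 (Edge D)

IsOutTree IsInTree : (D : Digraph) → V D → Set
IsOutTree D r = IsOrientedTree D × (∀ v → v ≢ r → Digraph.inDegree D v ≡ 1)
IsInTree  D r = IsOrientedTree D × (∀ v → v ≢ r → Digraph.outDegree D v ≡ 1)

HasOutBranching HasInBranching : Digraph → Set₁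
HasOutBranching D =
  Σ[ B ∈ SpanningSubdigraph D ] ∃[ r ] IsOutTree (SpanningSubdigraph.digraph B) r
HasInBranching D =
  Σ[ B ∈ SpanningSubdigraph D ] ∃[ r ] IsInTree (SpanningSubdigraph.digraph B) r

Σ-Fin↔ : ∀ {n} (f : Fin n → ℕ) → Σ (Fin n) (Fin ∘ f) ↔ Fin (foldr _+_ 0 f)
Σ-Fin↔ {zero}  f = mk↔ₛ′ (λ { (() , _) }) (λ ()) (λ ()) (λ { (() , _) })
Σ-Fin↔ {suc n} f = ↔-sym +↔⊎ ↔-∘ ((↔-id _ ⊎-↔ Σ-Fin↔ (f ∘ suc)) ↔-∘ split)
  where
  split : Σ (Fin (suc n)) (Fin ∘ f) ↔ (Fin (f zero) ⊎ Σ (Fin n) (Fin ∘ f ∘ suc))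
  split = mk↔ₛ′
    (λ { (zero , k) → inj₁ k ; (suc i , k) → inj₂ (i , k) })
    (λ { (inj₁ k) → zero , k ; (inj₂ (i , k)) → suc i , k })
    (λ { (inj₁ _) → refl ; (inj₂ _) → refl })
    (λ { (zero , _) → refl ; (suc _ , _) → refl })

-- T[H₁,…,H_t], with the H_i indexed by the vertices of T. The Σ-type makes
-- their vertex sets disjoint.
module Composition (T : Digraph) (H : V T → Digraph) where

  CompV : Set
  CompV = Σ (V T) (λ i → V (H i))

  data CompArc : Rel CompV 0ℓ where
    inner : ∀ {i x y} → Arc (H i) x y → CompArc (i , x) (i , y)
    outer : ∀ {i p x y} → Arc T i p → CompArc (i , x) (p , y)

  compArc? : Decidable CompArc
  compArc? (i , x) (p , y) with Digraph.arc? T i p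
  ... | yes a = yes (outer a)
  ... | no ¬a with Digraph._≟V_ T i p
  ...   | no i≢p = no λ { (inner _) → i≢p refl ; (outer a) → ¬a a }
  ...   | yes refl with Digraph.arc? (H i) x y
  ...     | yes b = yes (inner b)
  ...     | no ¬b = no λ { (inner b) → ¬b b ; (outer a) → ¬a a }

  compNoLoop : ∀ {v} → ¬ CompArc v v
  compNoLoop {i , _} (inner a) = Digraph.no-loop (H i) a
  compNoLoop         (outer a) = Digraph.no-loop T a

  orders : Fin (order T) → ℕ
  orders j = order (H (Inverse.from (Digraph.enum T) j))

  compEnum : CompV ↔ Fin (foldr _+_ 0 orders)
  compEnum = Σ-Fin↔ orders ↔-∘
    ↔-sym (Σ-↔ (↔-sym (Digraph.enum T)) (λ {j} → ↔-sym (Digraph.enum (H (Inverse.from (Digraph.enum T) j)))))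

  composition : Digraph
  composition = record
    { V       = CompV
    ; order   = foldr _+_ 0 orders
    ; enum    = compEnum
    ; Arc     = CompArc
    ; arc?    = compArc?
    ; no-loop = compNoLoop
    }

open Composition public using (composition)

{-# OPTIONS --safe #-}

-- Split V(Q) into a lower layer L and its complement, and keep the arcs that
-- go from L to its complement, those inside L that increase a rank d₁, and
-- those inside the complement that decrease a rank d₂.  This is always acyclic.
-- It has the required source r and sink s as soon as every vertex of L has an
-- out-neighbour outside L and, unless it is r, an in-neighbour of smaller d₁ in
-- L, and dually for the complement of L and s.
--
-- In case (a), r and s are the roots of an out- and an in-branching, L consists
-- of the H_i for which u_i cannot be reached in T from the vertex carrying s,
-- and the ranks are the distances from r and to s in Q.  As T is semicomplete,
-- L dominates s and r dominates the complement of L.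
--
-- In case (b), fix u_p ≠ u_q in T and a_i ≠ b_i in each H_i.  Let L contain
-- a_i for i ≠ q, and all of H_q except b_q.  The ranks are the distances from
-- u_p and to u_q in T, the source is a_p and the sink is b_q.
module Submission where

open import Defs
open import Data.Fin.Base using (Fin; zero; suc; toℕ; fromℕ<)
open import Data.Fin.Properties using (any?; inj⇒≟; injective⇒≤; toℕ-fromℕ<)
open import Data.List.Base using (List; []; _∷_; length; filter; lookup)
open import Data.List.Membership.Propositional using (_∈_)
open import Data.List.Membership.Propositional.Properties using (∈-lookup; ∈-filter⁻)
import Data.List.Membership.DecPropositional as DecMembership
open import Data.List.Properties using (filter-none)
open import Data.List.Relation.Binary.Subset.Propositional using (_⊆_)
open import Data.List.Relation.Binary.Subset.Propositional.Properties using (All-resp-⊇; ∷⁺ʳ)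
open import Data.List.Relation.Unary.All as All using (All; []; _∷_)
open import Data.List.Relation.Unary.All.Properties using (¬Any⇒All¬)
open import Data.List.Relation.Unary.AllPairs using ([]; _∷_)
open import Data.List.Relation.Unary.Any using (here; there)
open import Data.List.Relation.Unary.Unique.Propositional using (Unique)
open import Data.Nat.Base using (ℕ; zero; suc; _+_; _≤_; _<_; z≤n; s≤s)
open import Data.Nat.Induction using (<-wellFounded)
open import Data.Nat.Properties using (_<?_; <-trans; <-irrefl; ≤-refl; ≤-trans; +-suc; +-identityʳ; n≮0)
open import Data.Product.Base using (Σ-syntax; ∃-syntax; _×_; _,_; proj₁; proj₂)
open import Data.Sum.Base using (_⊎_; inj₁; inj₂)
open import Function.Base using (_∘_; flip; id)
open import Function.Bundles using (_↔_; Inverse)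
open import Function.Properties.Inverse using (↔⇒↣)
open import Induction.WellFounded using (Acc; acc)
open import Level using (0ℓ)
open import Relation.Binary.Construct.Closure.ReflexiveTransitive as Star using (Star; ε; _◅_; _◅◅_)
open import Relation.Binary.Construct.Closure.Symmetric using (fwd; bwd)
open import Relation.Binary.Core using (Rel; _⇒_)
open import Relation.Binary.Definitions using (Decidable; DecidableEquality; Transitive)
open import Relation.Binary.PropositionalEquality using (_≡_; _≢_; refl; sym; trans; cong; subst; ≢-sym)
open import Relation.Nullary using (¬_; Dec; yes; no; ¬?; contradiction; _×-dec_; _⊎-dec_)
open import Relation.Nullary.Decidable using (map′; decidable-stable)
import Relation.Unary as U

-- Cutting walks down to paths and cycles.

module _ {A : Set} {R : Rel A 0ℓ} where

  -- The inclusion is carried along for the induction: it shows that the head of the walk, absent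
  -- from the rest, is absent from the shorter prefix too.
  path-prefix : ∀ {x y u} (w : Star R x y) → u ∈ walkVertices w →
    Σ[ p ∈ Star R x u ]
      (walkVertices p ⊆ walkVertices w × (Unique (walkVertices w) → Unique (walkVertices p)))
  path-prefix ε       (here refl) = ε , id , id
  path-prefix (_ ◅ w) (here refl) = ε , (λ { (here e) → here e }) , λ _ → [] ∷ []
  path-prefix (a ◅ w) (there u∈w) with path-prefix w u∈w
  ... | p , p⊆w , unique =
    a ◅ p , ∷⁺ʳ _ p⊆w , λ { (x∉w ∷ w!) → All-resp-⊇ p⊆w x∉w ∷ unique w! }

  path-suffix : ∀ {x y u} (w : Star R x y) → Unique (walkVertices w) →
    u ∈ walkVertices w → Path R u y
  path-suffix ε       w!       (here refl) = ε , w!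
  path-suffix (a ◅ w) w!       (here refl) = a ◅ w , w!
  path-suffix (a ◅ w) (_ ∷ w!) (there u∈w) = path-suffix w w! u∈w

  star⇒path : DecidableEquality A → ∀ {x y} → Star R x y → Path R x y
  star⇒path _≟_ ε = ε , [] ∷ []
  star⇒path _≟_ {x} (a ◅ w) with star⇒path _≟_ w
  ... | p , p! with DecMembership._∈?_ _≟_ x (walkVertices p)
  ...   | yes x∈p = path-suffix p p! x∈p
  ...   | no  x∉p = a ◅ p , ¬Any⇒All¬ _ x∉p ∷ p!

  first-step : ∀ {x y} → Star R x y → x ≢ y → ∃[ w ] R x w
  first-step ε       x≢x = contradiction refl x≢x
  first-step (a ◅ _) _   = _ , a

walkVertices-map : ∀ {A : Set} {R E : Rel A 0ℓ} (R⇒E : R ⇒ E) {x y} (w : Star R x y) →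
  walkVertices (Star.map R⇒E w) ≡ walkVertices w
walkVertices-map R⇒E ε       = refl
walkVertices-map R⇒E (_ ◅ w) = cong (_ ∷_) (walkVertices-map R⇒E w)

-- With fewer than three vertices the closing arc would form a loop or a 2-cycle in `R`, which
-- antisymmetry excludes. `E` is kept apart from `R` so that arcs of either direction can yield
-- cycles of underlying edges.
closed-path⇒cycle : ∀ {A : Set} {R E : Rel A 0ℓ} → R ⇒ E → (∀ {x y} → R x y → ¬ R y x) →
  ∀ {x y} → Path R x y → R y x → Cycle 3 E
closed-path⇒cycle {A} {R} {E} R⇒E oriented (w , w!) a =
  _ , _ , (Star.map R⇒E w , subst Unique (sym (walkVertices-map R⇒E w)) w!) ,
  subst (λ vs → 3 ≤ length vs) (sym (walkVertices-map R⇒E w)) (long w a) , R⇒E a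
  where
  long : ∀ {x y} (w : Star R x y) → R y x → 3 ≤ length (walkVertices w)
  long ε               a = contradiction a (oriented a)
  long (b ◅ ε)         a = contradiction a (oriented b)
  long (_ ◅ _ ◅ ε)     _ = s≤s (s≤s (s≤s z≤n))
  long (_ ◅ _ ◅ _ ◅ _) _ = s≤s (s≤s (s≤s z≤n))

-- Monotone walks and descent along a rank.

module _ {A : Set} {R _≺_ : Rel A 0ℓ} (R⇒≺ : R ⇒ _≺_)
         (≺-trans : Transitive _≺_) (≺-irrefl : ∀ {x} → ¬ x ≺ x) where

  ≺-above-walk : ∀ {u x y} → u ≺ x → (w : Star R x y) → All (u ≺_) (walkVertices w)
  ≺-above-walk u≺x ε       = u≺x ∷ []
  ≺-above-walk u≺x (a ◅ w) = u≺x ∷ ≺-above-walk (≺-trans u≺x (R⇒≺ a)) w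

  monotone-walk-unique : ∀ {x y} (w : Star R x y) → Unique (walkVertices w)
  monotone-walk-unique ε       = [] ∷ []
  monotone-walk-unique (a ◅ w) =
    All.map (λ { x≺x refl → ≺-irrefl x≺x }) (≺-above-walk (R⇒≺ a) w) ∷ monotone-walk-unique w

  monotone-no-return : ∀ {x y} → Star R x y → ¬ R y x
  monotone-no-return ε       b = ≺-irrefl (R⇒≺ b)
  monotone-no-return (a ◅ w) b = monotone-no-return′ (R⇒≺ a) w b
    where
    -- The start `u` stays fixed while the walk is consumed, and transitivity keeps it below the
    -- current vertex.
    monotone-no-return′ : ∀ {u x y} → u ≺ x → Star R x y → ¬ R y u
    monotone-no-return′ u≺x ε       b = ≺-irrefl (≺-trans u≺x (R⇒≺ b))
    monotone-no-return′ u≺x (a ◅ w) b = monotone-no-return′ (≺-trans u≺x (R⇒≺ a)) w b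

descent : ∀ {A : Set} {R : Rel A 0ℓ} → DecidableEquality A →
  (P : A → Set) (d : A → ℕ) (t : A) →
  (∀ {z} → P z → z ≢ t → ∃[ w ] (R z w × P w × d w < d z)) →
  ∀ {z} → P z → Star R z t
descent {R = R} _≟_ P d t step Pz = go Pz (<-wellFounded _)
  where
  go : ∀ {z} → P z → Acc _<_ (d z) → Star R z t
  go {z} Pz (acc rs) with z ≟ t
  ... | yes refl = ε
  ... | no  z≢t with step Pz z≢t
  ...   | w , a , Pw , dw<dz = a ◅ go Pw (rs dw<dz)

least : ∀ {P : ℕ → Set} → U.Decidable P → ∀ n → P n →
  ∃[ m ] (P m × (∀ {k} → P k → m ≤ k))
least P? n Pn with P? 0
... | yes P0 = 0 , P0 , λ _ → z≤n
least P? zero    Pn | no ¬P0 = contradiction Pn ¬P0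
least {P} P? (suc n) Pn | no ¬P0 with least (P? ∘ suc) n Pn
... | m , Pm , min = suc m , Pm , minimal
  where
  minimal : ∀ {k} → P k → suc m ≤ k
  minimal {zero}  P0 = contradiction P0 ¬P0
  minimal {suc k} Pk = s≤s (min Pk)

-- Reachability and distance on a finite set.

Unique-lookup-injective : ∀ {A : Set} {xs : List A} → Unique xs →
  ∀ {i j} → lookup xs i ≡ lookup xs j → i ≡ j
Unique-lookup-injective (_ ∷ _)    {zero}  {zero}  _ = refl
Unique-lookup-injective (x∉xs ∷ _) {zero}  {suc j} e = contradiction e (All.lookup x∉xs (∈-lookup j))
Unique-lookup-injective (x∉xs ∷ _) {suc i} {zero}  e = contradiction (sym e) (All.lookup x∉xs (∈-lookup i))
Unique-lookup-injective (_ ∷ xs!)  {suc i} {suc j} e = cong suc (Unique-lookup-injective xs! e)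

module Finite {A : Set} {n : ℕ} (enum : A ↔ Fin n) where

  open Inverse enum using (to; from; strictlyInverseʳ)

  _≟_ : DecidableEquality A
  _≟_ = inj⇒≟ (↔⇒↣ enum)

  ∃? : ∀ {P : A → Set} → U.Decidable P → Dec (∃[ x ] P x)
  ∃? {P} P? = map′ (λ { (i , Pi) → from i , Pi })
                   (λ { (x , Px) → to x , subst P (sym (strictlyInverseʳ x)) Px })
                   (any? (P? ∘ from))

  Unique-length≤ : ∀ {xs} → Unique xs → length xs ≤ n
  Unique-length≤ {xs} xs! = injective⇒≤ {f = to ∘ lookup xs} λ e →
    Unique-lookup-injective xs! (trans (sym (strictlyInverseʳ _))
      (trans (cong from e) (strictlyInverseʳ _)))

  -- Extend a path ending in `v` backwards by predecessors. A repeated vertex would close a cycle,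
  -- so the path stays simple and must meet `r` before it exceeds `n` vertices. The fuel `k` of
  -- `grow` counts the extensions left.
  predecessors⇒reachable : ∀ {R E : Rel A 0ℓ} {r} → R ⇒ E → (∀ {x y} → R x y → ¬ R y x) →
    ¬ Cycle 3 E → (∀ v → v ≢ r → ∃[ u ] R u v) → ∀ v → Star R r v
  predecessors⇒reachable {R} {r = r} R⇒E oriented acyclic pred v = grow n ε ([] ∷ []) ≤-refl
    where
    grow : ∀ k {u} (w : Star R u v) → Unique (walkVertices w) →
      n < length (walkVertices w) + k → Star R r v
    grow zero w w! n<∣w∣ =
      contradiction (≤-trans (subst (n <_) (+-identityʳ _) n<∣w∣) (Unique-length≤ w!)) (<-irrefl refl)
    grow (suc k) {u} w w! n<∣w∣ with u ≟ r
    ... | yes refl = w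
    ... | no  u≢r with pred u u≢r
    ...   | u′ , a with DecMembership._∈?_ _≟_ u′ (walkVertices w)
    ...     | no u′∉w = grow k (a ◅ w) (¬Any⇒All¬ _ u′∉w ∷ w!) (subst (n <_) (+-suc _ k) n<∣w∣)
    ...     | yes u′∈w with path-prefix w u′∈w
    ...       | p , _ , unique =
      contradiction (closed-path⇒cycle R⇒E oriented (p , unique w!) a) acyclic

  module Walks {R : Rel A 0ℓ} (R? : Decidable R) where

    Walk : ℕ → Rel A 0ℓ
    Walk zero    x y = x ≡ y
    Walk (suc k) x y = ∃[ w ] (R x w × Walk k w y)

    walk? : ∀ k → Decidable (Walk k)
    walk? zero    x y = x ≟ y
    walk? (suc k) x y = ∃? λ w → R? x w ×-dec walk? k w y

    walk⇒star : ∀ k {x y} → Walk k x y → Star R x y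
    walk⇒star zero    refl        = ε
    walk⇒star (suc k) (_ , a , w) = a ◅ walk⇒star k w

    star⇒walk : ∀ {x y} (w : Star R x y) → ∃[ k ] (k < length (walkVertices w) × Walk k x y)
    star⇒walk ε       = 0 , s≤s z≤n , refl
    star⇒walk (a ◅ w) with star⇒walk w
    ... | k , k<∣w∣ , v = suc k , s≤s k<∣w∣ , _ , a , v

    -- A walk shortens to a path, which has at most `n` vertices and so fewer than `n` arcs; only
    -- lengths below `n` need testing.
    star? : Decidable (Star R)
    star? x y = map′ (λ { (k , w) → walk⇒star (toℕ k) w }) bounded
                     (any? λ (k : Fin n) → walk? (toℕ k) x y)
      where
      bounded : Star R x y → ∃[ k ] Walk (toℕ {n} k) x y
      bounded w with star⇒path _≟_ w
      ... | p , p! with star⇒walk p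
      ...   | k , k<∣p∣ , v =
        fromℕ< k<n , subst (λ m → Walk m x y) (sym (toℕ-fromℕ< k<n)) v
        where k<n = ≤-trans k<∣p∣ (Unique-length≤ p!)

    distance-to : ∀ t → (∀ z → Star R z t) → Σ[ d ∈ (A → ℕ) ]
      (d t ≡ 0 × (∀ z → z ≢ t → ∃[ w ] (R z w × d w < d z)))
    distance-to t reach = proj₁ ∘ shortest , d-target , d-step
      where
      shortest : ∀ z → ∃[ m ] (Walk m z t × (∀ {k} → Walk k z t → m ≤ k))
      shortest z with star⇒walk (reach z)
      ... | k , _ , w = least (λ m → walk? m z t) k w
      d-target : proj₁ (shortest t) ≡ 0
      d-target with shortest t
      ... | zero  , _ , _   = refl
      ... | suc m , _ , min = contradiction (min {0} refl) n≮0
      d-step : ∀ z → z ≢ t → ∃[ w ] (R z w × proj₁ (shortest w) < proj₁ (shortest z))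
      d-step z z≢t with shortest z
      ... | zero  , z≡t , _       = contradiction z≡t z≢t
      -- The tail `v` of a shortest walk has length `m`, which bounds the distance from `w`.
      ... | suc m , (w , a , v) , _ = w , a , s≤s (proj₂ (proj₂ (shortest w)) v)

-- Degrees, branchings and distances in digraphs.

module _ (D : Digraph) where

  open Digraph D using (enum; arc?; vertices)

  nonempty-filter⇒∃ : ∀ {P : V D → Set} (P? : U.Decidable P) →
    length (filter P? vertices) ≡ 1 → ∃[ x ] P x
  nonempty-filter⇒∃ P? len with filter P? vertices in eq
  ... | x ∷ _ = x , proj₂ (∈-filter⁻ P? {xs = vertices} (subst (x ∈_) (sym eq) (here refl)))

  empty-filter : ∀ {P : V D → Set} (P? : U.Decidable P) → (∀ x → ¬ P x) →
    length (filter P? vertices) ≡ 0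
  empty-filter P? ¬P = cong length (filter-none P? {vertices} (All.universal ¬P vertices))

  outTree⇒reachable : ∀ {r} → IsOutTree D r → ∀ v → Star (Arc D) r v
  outTree⇒reachable (tree , deg) =
    Finite.predecessors⇒reachable enum fwd oriented noCycle
      (λ v v≢r → nonempty-filter⇒∃ (λ w → arc? w v) (deg v v≢r))
    where open IsOrientedTree tree

  inTree⇒reachable : ∀ {r} → IsInTree D r → ∀ v → Star (Arc D) v r
  inTree⇒reachable (tree , deg) v = Star.reverse id
    -- Reversed arcs have the same underlying edges, so the argument for out-trees applies to them.
    (Finite.predecessors⇒reachable enum bwd oriented noCycle
      (λ v v≢r → nonempty-filter⇒∃ (λ w → arc? v w) (deg v v≢r)) v)
    where open IsOrientedTree tree

  distance-from : ∀ s → (∀ z → Star (Arc D) s z) → Σ[ d ∈ (V D → ℕ) ]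
    (d s ≡ 0 × (∀ z → z ≢ s → ∃[ w ] (Arc D w z × d w < d z)))
  distance-from s reach =
    Finite.Walks.distance-to enum (flip arc?) s (λ z → Star.reverse id (reach z))

  distance-to : ∀ t → (∀ z → Star (Arc D) z t) → Σ[ d ∈ (V D → ℕ) ]
    (d t ≡ 0 × (∀ z → z ≢ t → ∃[ w ] (Arc D z w × d w < d z)))
  distance-to = Finite.Walks.distance-to enum arc?

-- Layerings and the subdigraph they define.

HasAcyclicBipolarSpanningSubdigraph : Digraph → Set₁
HasAcyclicBipolarSpanningSubdigraph D =
  Σ[ S ∈ SpanningSubdigraph D ]
    let R = SpanningSubdigraph.digraph S in
    Acyclic R ×
    (∃[ x ] ∃[ y ]
      (Digraph.IsSource R x × Digraph.IsSink R y ×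
       (∀ (z : V D) → Path (Arc R) x z × Path (Arc R) z y)))

-- The conditions are local; `descent` along the ranks turns them into walks inside a layer. Rank
-- zero makes `r` minimal and `s` maximal in `_≺_`, hence a source and a sink.
record Layering (D : Digraph) : Set₁ where
  field
    L     : V D → Set
    L?    : U.Decidable L
    r s   : V D
    r∈L   : L r
    s∉L   : ¬ L s
    d₁ d₂ : V D → ℕ
    d₁-r  : d₁ r ≡ 0
    d₂-s  : d₂ s ≡ 0
    L-pred : ∀ {z} → L z → z ≢ r → ∃[ w ] (Arc D w z × L w × d₁ w < d₁ z)
    L-succ : ∀ {z} → L z → ∃[ w ] (Arc D z w × ¬ L w)
    U-pred : ∀ {z} → ¬ L z → ∃[ w ] (Arc D w z × L w)
    U-succ : ∀ {z} → ¬ L z → z ≢ s → ∃[ w ] (Arc D z w × ¬ L w × d₂ w < d₂ z)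

module _ {D : Digraph} (layering : Layering D) where

  open Layering layering
  open Digraph D using (arc?; _≟V_)

  -- A strict order placing all of `L` below its complement. Every arc kept increases in it, so no
  -- walk closes up and every walk is already a path.
  _≺_ : Rel (V D) 0ℓ
  u ≺ v = (L u × ¬ L v) ⊎ (L u × L v × d₁ u < d₁ v) ⊎ (¬ L u × ¬ L v × d₂ v < d₂ u)

  _≺?_ : Decidable _≺_
  u ≺? v = (L? u ×-dec ¬? (L? v)) ⊎-dec (L? u ×-dec L? v ×-dec d₁ u <? d₁ v)
           ⊎-dec (¬? (L? u) ×-dec ¬? (L? v) ×-dec d₂ v <? d₂ u)

  ≺-irrefl : ∀ {x} → ¬ x ≺ x
  ≺-irrefl (inj₁ (l , ¬l))              = ¬l l
  ≺-irrefl (inj₂ (inj₁ (_ , _ , d<d))) = <-irrefl refl d<d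
  ≺-irrefl (inj₂ (inj₂ (_ , _ , d<d))) = <-irrefl refl d<d

  ≺-trans : Transitive _≺_
  ≺-trans (inj₁ (_ , ¬l))              (inj₁ (l , _))              = contradiction l ¬l
  ≺-trans (inj₁ (_ , ¬l))              (inj₂ (inj₁ (l , _)))       = contradiction l ¬l
  ≺-trans (inj₁ (l , _))               (inj₂ (inj₂ (_ , ¬l , _)))  = inj₁ (l , ¬l)
  ≺-trans (inj₂ (inj₁ (l , _ , _)))    (inj₁ (_ , ¬l))             = inj₁ (l , ¬l)
  ≺-trans (inj₂ (inj₁ (l , _ , p)))    (inj₂ (inj₁ (_ , l′ , q)))  = inj₂ (inj₁ (l , l′ , <-trans p q))
  ≺-trans (inj₂ (inj₁ (_ , l , _)))    (inj₂ (inj₂ (¬l , _)))      = contradiction l ¬l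
  ≺-trans (inj₂ (inj₂ (_ , ¬l , _)))   (inj₁ (l , _))              = contradiction l ¬l
  ≺-trans (inj₂ (inj₂ (_ , ¬l , _)))   (inj₂ (inj₁ (l , _)))       = contradiction l ¬l
  ≺-trans (inj₂ (inj₂ (¬l , _ , p)))   (inj₂ (inj₂ (_ , ¬l′ , q))) = inj₂ (inj₂ (¬l , ¬l′ , <-trans q p))

  layered : SpanningSubdigraph D
  layered = record
    { SubArc  = λ u v → Arc D u v × u ≺ v
    ; subArc? = λ u v → arc? u v ×-dec u ≺? v
    ; subArc⊆ = proj₁
    }

  private
    R : Digraph
    R = SpanningSubdigraph.digraph layered

    nothing-below-r : ∀ w → ¬ w ≺ r
    nothing-below-r w (inj₁ (_ , r∉L))           = r∉L r∈L
    nothing-below-r w (inj₂ (inj₁ (_ , _ , d<))) = n≮0 (subst (d₁ w <_) d₁-r d<)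
    nothing-below-r w (inj₂ (inj₂ (_ , r∉L , _))) = r∉L r∈L

    nothing-above-s : ∀ w → ¬ s ≺ w
    nothing-above-s w (inj₁ (s∈L , _))            = s∉L s∈L
    nothing-above-s w (inj₂ (inj₁ (s∈L , _)))     = s∉L s∈L
    nothing-above-s w (inj₂ (inj₂ (_ , _ , d<)))  = n≮0 (subst (d₂ w <_) d₂-s d<)

    L-step : ∀ {z} → L z → z ≢ r → ∃[ w ] (Arc R w z × L w × d₁ w < d₁ z)
    L-step z∈L z≢r with L-pred z∈L z≢r
    ... | w , a , w∈L , d< = w , (a , inj₂ (inj₁ (w∈L , z∈L , d<))) , w∈L , d<

    U-step : ∀ {z} → ¬ L z → z ≢ s → ∃[ w ] (Arc R z w × ¬ L w × d₂ w < d₂ z)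
    U-step z∉L z≢s with U-succ z∉L z≢s
    ... | w , a , w∉L , d< = w , (a , inj₂ (inj₂ (z∉L , w∉L , d<))) , w∉L , d<

    from-r-in-L : ∀ {z} → L z → Star (Arc R) r z
    from-r-in-L z∈L = Star.reverse id (descent _≟V_ L d₁ r L-step z∈L)

    to-s-outside-L : ∀ {z} → ¬ L z → Star (Arc R) z s
    to-s-outside-L = descent _≟V_ (¬_ ∘ L) d₂ s U-step

    from-r : ∀ z → Star (Arc R) r z
    from-r z with L? z
    ... | yes z∈L = from-r-in-L z∈L
    ... | no  z∉L = let w , a , w∈L = U-pred z∉L in
      from-r-in-L w∈L ◅◅ (a , inj₁ (w∈L , z∉L)) ◅ ε

    to-s : ∀ z → Star (Arc R) z s
    to-s z with L? z
    ... | yes z∈L = let w , a , w∉L = L-succ z∈L in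
      (a , inj₁ (z∈L , w∉L)) ◅ to-s-outside-L w∉L
    ... | no  z∉L = to-s-outside-L z∉L

    monotone-path : ∀ {x y} → Star (Arc R) x y → Path (Arc R) x y
    monotone-path w = w , monotone-walk-unique {_≺_ = _≺_} proj₂ ≺-trans ≺-irrefl w

  layering⇒bipolar : HasAcyclicBipolarSpanningSubdigraph D
  layering⇒bipolar = layered ,
    (λ { (_ , _ , (w , _) , _ , a) → monotone-no-return {_≺_ = _≺_} proj₂ ≺-trans ≺-irrefl w a }) ,
    r , s ,
    empty-filter R (λ w → Digraph.arc? R w r) (λ w → nothing-below-r w ∘ proj₂) ,
    empty-filter R (λ w → Digraph.arc? R s w) (λ w → nothing-above-s w ∘ proj₂) ,
    λ z → monotone-path (from-r z) , monotone-path (to-s z)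

-- Choosing vertices, and walks in compositions.

module _ (D : Digraph) where

  open Inverse (Digraph.enum D) using (to; from; strictlyInverseˡ)

  some-vertex : 1 ≤ order D → V D
  some-vertex 1≤n = from (fromℕ< 1≤n)

  two-vertices : 2 ≤ order D → Σ[ x ∈ V D ] Σ[ y ∈ V D ] (x ≢ y)
  two-vertices (s≤s (s≤s _)) = from zero , from (suc zero) , λ e →
    contradiction (trans (sym (strictlyInverseˡ _)) (trans (cong to e) (strictlyInverseˡ _))) λ ()

  other-vertex : 2 ≤ order D → ∀ x → ∃[ y ] (x ≢ y)
  other-vertex 2≤n x with two-vertices 2≤n
  ... | y , z , y≢z with Digraph._≟V_ D x y
  ...   | yes refl = z , y≢z
  ...   | no  x≢y  = y , x≢y

module _ (T : Digraph) (H : V T → Digraph) where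

  private
    Q : Digraph
    Q = composition T H

  open Composition T H using (inner; outer)
  open Digraph T using () renaming (_≟V_ to _≟T_)

  project : ∀ {x y} → Star (Arc Q) x y → Star (Arc T) (proj₁ x) (proj₁ y)
  project ε             = ε
  project (inner _ ◅ w) = project w
  project (outer a ◅ w) = a ◅ project w

  -- An arc of `T` joins every vertex of one part to every vertex of the next, so intermediate
  -- vertices are arbitrary. Distinct ends exclude the trivial walk, which could not join two
  -- vertices of one part.
  lift : (∀ i → 1 ≤ order (H i)) → ∀ {i j} → Star (Arc T) i j → i ≢ j →
    ∀ u v → Star (Arc Q) (i , u) (j , v)
  lift 1≤∣H∣ ε       i≢i = contradiction refl i≢i
  lift 1≤∣H∣ (a ◅ w) _   = lift′ a w
    where
    lift′ : ∀ {i k j} → Arc T i k → Star (Arc T) k j → ∀ u v → Star (Arc Q) (i , u) (j , v)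
    lift′ a ε       u v = outer a ◅ ε
    lift′ a (b ◅ w) u v = outer a ◅ lift′ b w (some-vertex (H _) (1≤∣H∣ _)) v

  -- The non-strong case.

  nonstrong⇒bipolar : 2 ≤ order T → (∀ i → 1 ≤ order (H i)) → Semicomplete T →
    ¬ Strong Q → HasInBranching Q → HasOutBranching Q → HasAcyclicBipolarSpanningSubdigraph Q
  nonstrong⇒bipolar 2≤∣T∣ 1≤∣H∣ semicomplete ¬strong (B⁻ , s , B⁻-tree) (B⁺ , r , B⁺-tree) =
    layering⇒bipolar record
      { L = ¬_ ∘ S ∘ proj₁ ; L? = ¬? ∘ S? ∘ proj₁
      ; r = r ; s = s ; r∈L = ¬Sp ; s∉L = λ s∉S → s∉S ε
      ; d₁ = proj₁ from-r-distance ; d₂ = proj₁ to-s-distance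
      ; d₁-r = proj₁ (proj₂ from-r-distance) ; d₂-s = proj₁ (proj₂ to-s-distance)
      -- `S` is closed under out-neighbours, so shortest walks traced back from `L` stay in `L`, and
      -- those leaving its complement towards `s` stay outside.
      ; L-pred = λ {z} z∈L z≢r →
          let w , a , d< = proj₂ (proj₂ from-r-distance) z z≢r in
          w , a , (λ w∈S → z∈L (S-closed a w∈S)) , d<
      ; L-succ = λ z∈L → s , outer (to-q z∈L) , λ s∉S → s∉S ε
      ; U-pred = λ z∉L → r , outer (from-p (decidable-stable (S? _) z∉L)) , ¬Sp
      ; U-succ = λ {z} z∉L z≢s →
          let w , a , d< = proj₂ (proj₂ to-s-distance) z z≢s in
          w , a , (λ w∈L → z∉L (λ z∈S → w∈L (S-closed a z∈S))) , d<
      }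
    where
    p q : V T
    p = proj₁ r
    q = proj₁ s
    from-r : ∀ z → Star (Arc Q) r z
    from-r z = Star.map (SpanningSubdigraph.subArc⊆ B⁺)
      (outTree⇒reachable (SpanningSubdigraph.digraph B⁺) B⁺-tree z)
    to-s : ∀ z → Star (Arc Q) z s
    to-s z = Star.map (SpanningSubdigraph.subArc⊆ B⁻)
      (inTree⇒reachable (SpanningSubdigraph.digraph B⁻) B⁻-tree z)
    from-r-distance = distance-from Q r from-r
    to-s-distance   = distance-to Q s to-s
    S : V T → Set
    S = Star (Arc T) q
    S? : U.Decidable S
    S? = Finite.Walks.star? (Digraph.enum T) (Digraph.arc? T) q
    S-closed : ∀ {z w} → Arc Q z w → S (proj₁ z) → S (proj₁ w)
    S-closed a z∈S = z∈S ◅◅ project (a ◅ ε)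
    -- If r and s lie in the same H_i, a walk from s to r is obtained by a detour
    -- through another H_k, which r reaches and from which s is reached.
    s⇝r : S p → Star (Arc Q) s r
    s⇝r q⇝p with q ≟T p
    ... | no  q≢p = lift 1≤∣H∣ q⇝p q≢p _ _
    ... | yes q≡p with other-vertex T 2≤∣T∣ p
    ...   | k , p≢k =
      lift 1≤∣H∣ (subst (λ i → Star (Arc T) i k) (sym q≡p) (project (from-r h)))
        (λ q≡k → p≢k (trans (sym q≡p) q≡k)) _ _
      ◅◅ lift 1≤∣H∣ (subst (Star (Arc T) k) q≡p (project (to-s h))) (≢-sym p≢k) (proj₂ h) _
      where
      h : V Q
      h = k , some-vertex (H k) (1≤∣H∣ k)
    -- Otherwise any `x` would reach any `y` by way of `s` and then `r`.
    ¬Sp : ¬ S p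
    ¬Sp q⇝p = ¬strong λ x y →
      star⇒path (Digraph._≟V_ Q) (to-s x ◅◅ s⇝r q⇝p ◅◅ from-r y)
    -- The opposite arc would put `i` into `S`; in `from-p` it would put `p` there.
    to-q : ∀ {i} → ¬ S i → Arc T i q
    to-q {i} ¬Si with semicomplete i q (λ { refl → ¬Si ε })
    ... | inj₁ a = a
    ... | inj₂ a = contradiction (a ◅ ε) ¬Si
    from-p : ∀ {i} → S i → Arc T p i
    from-p {i} Si with semicomplete p i (λ { refl → ¬Sp Si })
    ... | inj₁ a = a
    ... | inj₂ a = contradiction (Si ◅◅ a ◅ ε) ¬Sp

  -- The strong case.

  strong⇒bipolar : 2 ≤ order T → Strong Q → (∀ i → 2 ≤ order (H i)) →
    HasAcyclicBipolarSpanningSubdigraph Q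
  strong⇒bipolar 2≤∣T∣ strong 2≤∣H∣ with two-vertices T 2≤∣T∣
  ... | p , q , p≢q = layering⇒bipolar record
      { L = L ; L? = L?
      ; r = p , a p ; s = q , b q ; r∈L = a∈L p ; s∉L = b∉L q
      ; d₁ = proj₁ from-p-distance ∘ proj₁ ; d₂ = proj₁ to-q-distance ∘ proj₁
      ; d₁-r = proj₁ (proj₂ from-p-distance) ; d₂-s = proj₁ (proj₂ to-q-distance)
      ; L-pred = λ {z} z∈L z≢r →
          let j , e , d< = proj₂ (proj₂ from-p-distance) (proj₁ z) (L-not-p z∈L z≢r) in
          (j , a j) , outer e , a∈L j , d<
      -- An arc of `T` from or to the part of `z` serves every vertex of that part, and the other
      -- end may be chosen in either layer: `a j` lies in `L`, `b j` outside.
      ; L-succ = λ {z} _ → let j , e = successor (proj₁ z) in (j , b j) , outer e , b∉L j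
      ; U-pred = λ {z} _ → let j , e = predecessor (proj₁ z) in (j , a j) , outer e , a∈L j
      ; U-succ = λ {z} z∉L z≢s →
          let j , e , d< = proj₂ (proj₂ to-q-distance) (proj₁ z) (U-not-q z∉L z≢s) in
          (j , b j) , outer e , b∉L j , d<
      }
    where
    a b : ∀ i → V (H i)
    a i = proj₁ (two-vertices (H i) (2≤∣H∣ i))
    b i = proj₁ (proj₂ (two-vertices (H i) (2≤∣H∣ i)))
    a≢b : ∀ i → a i ≢ b i
    a≢b i = proj₂ (proj₂ (two-vertices (H i) (2≤∣H∣ i)))
    -- The ranks are constant on each part, so no arc inside a part can change them. Hence `a p`
    -- must be the only vertex of `L` over `p`, and `b q` the only one outside `L` over `q`; this
    -- explains the exception at `q` and uses `p ≢ q`.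
    L : V Q → Set
    L (i , v) = (i ≡ q × v ≢ b i) ⊎ (i ≢ q × v ≡ a i)
    L? : U.Decidable L
    L? (i , v) = (i ≟T q ×-dec ¬? (Digraph._≟V_ (H i) v (b i)))
                 ⊎-dec (¬? (i ≟T q) ×-dec Digraph._≟V_ (H i) v (a i))
    a∈L : ∀ i → L (i , a i)
    a∈L i with i ≟T q
    ... | yes i≡q = inj₁ (i≡q , a≢b i)
    ... | no  i≢q = inj₂ (i≢q , refl)
    b∉L : ∀ i → ¬ L (i , b i)
    b∉L i (inj₁ (_ , b≢b)) = b≢b refl
    b∉L i (inj₂ (_ , b≡a)) = a≢b i (sym b≡a)
    L-not-p : ∀ {z} → L z → z ≢ (p , a p) → proj₁ z ≢ p
    L-not-p (inj₁ (p≡q , _))   z≢r refl = p≢q p≡q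
    L-not-p (inj₂ (_ , refl))  z≢r refl = z≢r refl
    U-not-q : ∀ {z} → ¬ L z → z ≢ (q , b q) → proj₁ z ≢ q
    U-not-q {_ , v} z∉L z≢s refl =
      z∉L (inj₁ (refl , λ { refl → z≢s refl }))
    T-strong : ∀ i j → Star (Arc T) i j
    T-strong i j = project (proj₁ (strong (i , a i) (j , a j)))
    from-p-distance = distance-from T p (T-strong p)
    to-q-distance   = distance-to T q (λ i → T-strong i q)
    successor : ∀ i → ∃[ j ] Arc T i j
    successor i with other-vertex T 2≤∣T∣ i
    ... | j , i≢j = first-step (T-strong i j) i≢j
    predecessor : ∀ i → ∃[ j ] Arc T j i
    predecessor i with other-vertex T 2≤∣T∣ i
    ... | j , i≢j = first-step {R = flip (Arc T)} (Star.reverse id (T-strong j i)) i≢j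

theorem6p2 : (T : Digraph) (H : V T → Digraph) →
    2 ≤ order T →
    (∀ i → 1 ≤ order (H i)) →
    Semicomplete T →
    let Q = composition T H in
    (¬ Strong Q × HasInBranching Q × HasOutBranching Q) ⊎ (Strong Q × (∀ i → 2 ≤ order (H i))) →
    Σ[ S ∈ SpanningSubdigraph Q ]
    let R = SpanningSubdigraph.digraph S in
    Acyclic R ×
    (∃[ x ] ∃[ y ]
    (Digraph.IsSource R x × Digraph.IsSink R y ×
    (∀ (z : V Q) → Path (Arc R) x z × Path (Arc R) z y)))
theorem6p2 T H 2≤∣T∣ 1≤∣H∣ semicomplete (inj₁ (¬strong , B⁻ , B⁺)) =
  nonstrong⇒bipolar T H 2≤∣T∣ 1≤∣H∣ semicomplete ¬strong B⁻ B⁺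
theorem6p2 T H 2≤∣T∣ _ _ (inj₂ (strong , 2≤∣H∣)) =
  strong⇒bipolar T H 2≤∣T∣ strong 2≤∣H∣
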